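{- For all $q\ge 4$ and all integers $n\ge 1$, $\kappa^{\min}_{n,q}\ge \lfloor n/2-\log_q(n)\rfloor$.
   Context: Let $q\ge 2$, $A=\{0,1,\dots,q-1\}$, $[n]=\{1,\dots,n\}$, and let $F(n,q)$ be the set of all maps $A^n\to A^n$. For $f\in F(m,q)$ and $i\in[m]$, $f_i$ is the $i$-th coordinate function and $f^i(x)=(x_1,\dots,x_{i-1},f_i(x),x_{i+1},\dots,x_m)$; for a word $w=(w_1,\dots,w_t)$ over $[m]$, $f^w=f^{w_t}\circ\cdots\circ f^{w_1}$. $\Pi([m])$ is the set of permutations of $[m]$ written as words $(w_1,\dots,w_m)$. $\mathrm{pr}_{[n]}:A^m\to A^n$ is the projection onto the first $n$ coordinates. For $m\ge n$, $(f,w)$ with $f\in F(m,q)$, $w\in\Pi([m])$ sequentializes $h\in F(n,q)$ if $\mathrm{pr}_{[n]}\circ f^w=h\circ\mathrm{pr}_{[n]}$. $\kappa^{\min}(h)$ is the smallest $k\ge 0$ such that there exist $f\in F(n+k,q)$ and $w\in\Pi([n+k])$ with $(f,w)$ sequentializing $h$, and $\kappa^{\min}_{n,q}=\max\{\kappa^{\min}(h): h\in F(n,q)\}$. -}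

module Defs where

open import Data.Fin.Base using (Fin; zero; suc; _↑ˡ_; _↑ʳ_; splitAt; join; funToFin; finToFun)
import Data.Fin.Properties as Fin
open import Data.Integer.Base as ℤ using (ℤ; +_; -[1+_])
import Data.Integer.Properties as ℤ
open import Data.Nat.Base as ℕ using (ℕ; zero; suc; z≤n; s≤s)
import Data.Nat.Properties as ℕ
open import Data.Product.Base using (Σ; ∃; _×_; _,_; proj₁; proj₂)
open import Data.Rational.Unnormalised.Base as ℚᵘ using (ℚᵘ; mkℚᵘ)
open import Data.Sum.Base using (_⊎_; inj₁; inj₂; [_,_]′; swap)
open import Data.Sum.Properties using (swap-involutive)
open import Data.Vec.Base using (Vec; []; _∷_; _++_; lookup; map; tabulate; take; drop; allFin; _[_]≔_)
import Data.Vec.Properties as Vec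
open import Function.Base using (_∘_)
open import Function.Consequences.Propositional using (strictlySurjective⇒surjective)
open import Function.Definitions using (Bijective)
open import Relation.Binary.PropositionalEquality
open import Relation.Nullary.Decidable using (Dec; yes; no; map′; _×-dec_; _→-dec_)
open import Relation.Nullary.Negation using (¬_; contradiction)

IsLeast IsGreatest : {A : Set} → (A → A → Set) → (A → Set) → A → Set
IsLeast    _≤_ P k = P k × (∀ j → P j → k ≤ j)
IsGreatest _≤_ P k = P k × (∀ j → P j → j ≤ k)

State : ℕ → ℕ → Set
State n q = Vec (Fin q) n

F : ℕ → ℕ → Set
F n q = State n q → State n q

-- f ⟪ i ⟫ is fⁱ: only the i-th coordinate is updated.
_⟪_⟫ : ∀ {m q} → F m q → Fin m → F m q
(f ⟪ i ⟫) x = x [ i ]≔ lookup (f x) i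

-- f ^ʷ w = f^{w_t} ∘ ⋯ ∘ f^{w_1}: the first letter acts first.
_^ʷ_ : ∀ {m q t} → F m q → Vec (Fin m) t → F m q
(f ^ʷ [])      x = x
(f ^ʷ (i ∷ w)) x = (f ^ʷ w) ((f ⟪ i ⟫) x)

IsPermutation : ∀ {m} → Vec (Fin m) m → Set
IsPermutation w = Bijective _≡_ _≡_ (lookup w)

Π : ℕ → Set
Π m = Σ (Vec (Fin m) m) IsPermutation

Sequentializes : ∀ {n q} k → F (n ℕ.+ k) q → Π (n ℕ.+ k) → F n q → Set
Sequentializes {n} k f (w , _) h = ∀ x → take n ((f ^ʷ w) x) ≡ h (take n x)

SequentializableWith : ∀ {n q} → F n q → ℕ → Set
SequentializableWith {n} {q} h k =
  ∃ λ (f : F (n ℕ.+ k) q) → ∃ λ (w : Π (n ℕ.+ k)) → Sequentializes k f w h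

least : {P : ℕ → Set} → (∀ k → Dec (P k)) → ∀ n → P n → ∃ (IsLeast ℕ._≤_ P)
least P? n pn with P? 0
... | yes p0 = 0 , p0 , λ _ _ → z≤n
least P? zero    pn | no ¬p0 = contradiction pn ¬p0
least {P} P? (suc n) pn | no ¬p0 with least {P ∘ suc} (P? ∘ suc) n pn
... | k , pk , min = suc k , pk , λ
  { zero    p0 → contradiction p0 ¬p0
  ; (suc j) pj → s≤s (min j pj) }

greatest : {P : ℕ → Set} → (∀ k → Dec (P k)) → ∀ b → (∀ k → P k → k ℕ.≤ b) →
           ∃ P → ∃ (IsGreatest ℕ._≤_ P)
greatest P? b bnd (a , pa) with P? b
... | yes pb = b , pb , bnd
greatest {P} P? zero    bnd (a , pa) | no ¬pb =
  contradiction (subst P (ℕ.n≤0⇒n≡0 (bnd a pa)) pa) ¬pb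
greatest {P} P? (suc b) bnd e | no ¬pb = greatest P? b bnd′ e
  where
  bnd′ : ∀ k → P k → k ℕ.≤ b
  bnd′ k pk = ℕ.s≤s⁻¹ (ℕ.≤∧≢⇒< (bnd k pk) λ { refl → ¬pb pk })

encV : ∀ {n q} → Vec (Fin q) n → Fin (q ℕ.^ n)
encV v = funToFin (lookup v)

decV : ∀ {n q} → Fin (q ℕ.^ n) → Vec (Fin q) n
decV {n} {q} i = tabulate (finToFun {q} {n} i)

decV-encV : ∀ {n q} (v : Vec (Fin q) n) → decV (encV v) ≡ v
decV-encV v = trans (Vec.tabulate-cong (Fin.finToFun-funToFin (lookup v)))
                    (Vec.tabulate∘lookup v)

CodeF : ℕ → ℕ → Set
CodeF n q = Fin ((q ℕ.^ n) ℕ.^ (q ℕ.^ n))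

encF : ∀ {n q} → F n q → CodeF n q
encF f = funToFin (encV ∘ f ∘ decV)

decF : ∀ {n q} → CodeF n q → F n q
decF {n} {q} j = decV ∘ finToFun {q ℕ.^ n} {q ℕ.^ n} j ∘ encV

-- Round trip only pointwise, for lack of function extensionality.
decF-encF : ∀ {n q} (f : F n q) → decF (encF f) ≗ f
decF-encF f v = begin
  decF (encF f) v             ≡⟨ cong decV (Fin.finToFun-funToFin (encV ∘ f ∘ decV) (encV v)) ⟩
  decV (encV (f (decV (encV v)))) ≡⟨ decV-encV _ ⟩
  f (decV (encV v))           ≡⟨ cong f (decV-encV v) ⟩
  f v                         ∎
  where open ≡-Reasoning

allV? : ∀ {n q} {P : Vec (Fin q) n → Set} → (∀ v → Dec (P v)) → Dec (∀ v → P v)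
allV? {P = P} P? = map′ (λ a v → subst P (decV-encV v) (a (encV v))) (λ a i → a (decV i))
                        (Fin.all? (P? ∘ decV))

anyV? : ∀ {n q} {P : Vec (Fin q) n → Set} → (∀ v → Dec (P v)) → Dec (∃ P)
anyV? {P = P} P? = map′ (λ { (i , p) → decV i , p })
                        (λ { (v , p) → encV v , subst P (sym (decV-encV v)) p })
                        (Fin.any? (P? ∘ decV))

anyF? : ∀ {n q} {P : F n q → Set} → (∀ {f g} → f ≗ g → P f → P g) →
        (∀ f → Dec (P f)) → Dec (∃ P)
anyF? transfer P? = map′ (λ { (i , p) → decF i , p })
                     (λ { (f , p) → encF f , transfer (sym ∘ decF-encF f) p })
                     (Fin.any? (P? ∘ decF))

isPermutation? : ∀ {m} (w : Vec (Fin m) m) → Dec (IsPermutation w)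
isPermutation? w = map′
  (λ { (inj , sur) → (λ {x} {y} → inj x y) , strictlySurjective⇒surjective sur })
  (λ { (inj , sur) → (λ x y → inj {x} {y}) , λ y → proj₁ (sur y) , proj₂ (sur y) refl })
  (Fin.all? (λ x → Fin.all? λ y → (lookup w x Fin.≟ lookup w y) →-dec (x Fin.≟ y))
    ×-dec Fin.all? (λ y → Fin.any? λ x → lookup w x Fin.≟ y))

^ʷ-cong : ∀ {m q t} {f g : F m q} → f ≗ g → (w : Vec (Fin m) t) → f ^ʷ w ≗ g ^ʷ w
^ʷ-cong f≗g []      x = refl
^ʷ-cong {f = f} {g} f≗g (i ∷ w) x =
  trans (^ʷ-cong f≗g w _) (cong (λ y → (g ^ʷ w) (x [ i ]≔ lookup y i)) (f≗g x))

sequentializableWith? : ∀ {n q} (h : F n q) k → Dec (SequentializableWith h k)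
sequentializableWith? {n} {q} h k = anyF? transfer λ f → map′
  (λ { (w , p , s) → (w , p) , s })
  (λ { ((w , p) , s) → w , p , s })
  (anyV? λ w → isPermutation? w ×-dec
    allV? λ x → Vec.≡-dec Fin._≟_ (take n ((f ^ʷ w) x)) (h (take n x)))
  where
  transfer : {f g : F (n ℕ.+ k) q} → f ≗ g →
         (∃ λ w → Sequentializes k f w h) → ∃ λ w → Sequentializes k g w h
  transfer f≗g (w , s) =
    w , λ x → trans (cong (take n) (sym (^ʷ-cong f≗g (proj₁ w) x))) (s x)

-- n additional coordinates suffice: they first store h(x), which is then
-- copied back.
module _ {n q : ℕ} (h : F n q) where

  private
    take-++ : ∀ {m k} (a : State m q) (b : State k q) → take m (a ++ b) ≡ a
    take-++ []      b = refl
    take-++ (x ∷ a) b = cong (x ∷_) (take-++ a b)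

    drop-++ : ∀ {m k} (a : State m q) (b : State k q) → drop m (a ++ b) ≡ b
    drop-++ []      b = refl
    drop-++ (x ∷ a) b = drop-++ a b

    ^ʷ-++ : ∀ {m s t} (f : F m q) (u : Vec (Fin m) s) (v : Vec (Fin m) t) x →
            (f ^ʷ (u ++ v)) x ≡ (f ^ʷ v) ((f ^ʷ u) x)
    ^ʷ-++ f []      v x = refl
    ^ʷ-++ f (i ∷ u) v x = ^ʷ-++ f u v _

    assign : ∀ {m t} → Vec (Fin m) t → State m q → F m q
    assign w c = (λ _ → c) ^ʷ w

    assign-keep : ∀ {m t} (w : Vec (Fin m) t) c b i →
                  lookup b i ≡ lookup c i → lookup (assign w c b) i ≡ lookup c i
    assign-keep []      c b i eq = eq
    assign-keep (j ∷ w) c b i eq with i Fin.≟ j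
    ... | yes refl = assign-keep w c _ i (Vec.lookup∘update i b _)
    ... | no i≢j   = assign-keep w c _ i (trans (Vec.lookup∘update′ i≢j b _) eq)

    assign-set : ∀ {m t} (w : Vec (Fin m) t) c b k →
                 lookup (assign w c b) (lookup w k) ≡ lookup c (lookup w k)
    assign-set (i ∷ w) c b zero    = assign-keep w c _ i (Vec.lookup∘update i b _)
    assign-set (i ∷ w) c b (suc k) = assign-set w c _ k

    assign-all : ∀ {m} (c b : State m q) → assign (allFin m) c b ≡ c
    assign-all c b = begin
      assign (allFin _) c b                     ≡⟨ Vec.tabulate∘lookup _ ⟨
      tabulate (lookup (assign (allFin _) c b)) ≡⟨ Vec.tabulate-cong pt ⟩
      tabulate (lookup c)                       ≡⟨ Vec.tabulate∘lookup c ⟩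
      c                                         ∎
      where
      open ≡-Reasoning
      pt : ∀ i → lookup (assign (allFin _) c b) i ≡ lookup c i
      pt i = subst (λ j → lookup (assign (allFin _) c b) j ≡ lookup c j)
                   (Vec.lookup-allFin i) (assign-set (allFin _) c b i)

    f : F (n ℕ.+ n) q
    f x = drop n x ++ h (take n x)

    f-++ : ∀ a b → f (a ++ b) ≡ b ++ h a
    f-++ a b = cong₂ (λ b a → b ++ h a) (drop-++ a b) (take-++ a b)

    phase₁ : ∀ {t} (w : Vec (Fin n) t) a b →
             (f ^ʷ map (n ↑ʳ_) w) (a ++ b) ≡ a ++ assign w (h a) b
    phase₁ []      a b = refl
    phase₁ (i ∷ w) a b = trans (cong (f ^ʷ map (n ↑ʳ_) w) step) (phase₁ w a _)
      where
      step : (f ⟪ n ↑ʳ i ⟫) (a ++ b) ≡ a ++ (b [ i ]≔ lookup (h a) i)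
      step = trans (Vec.[]≔-++-↑ʳ a b i)
        (cong (λ z → a ++ (b [ i ]≔ z))
          (trans (cong (λ y → lookup y (n ↑ʳ i)) (f-++ a b)) (Vec.lookup-++ʳ b (h a) i)))

    phase₂ : ∀ {t} (w : Vec (Fin n) t) a b →
             (f ^ʷ map (_↑ˡ n) w) (a ++ b) ≡ assign w b a ++ b
    phase₂ []      a b = refl
    phase₂ (i ∷ w) a b = trans (cong (f ^ʷ map (_↑ˡ n) w) step) (phase₂ w _ b)
      where
      step : (f ⟪ i ↑ˡ n ⟫) (a ++ b) ≡ (a [ i ]≔ lookup b i) ++ b
      step = trans (Vec.[]≔-++-↑ˡ a b i)
        (cong (λ z → (a [ i ]≔ z) ++ b)
          (trans (cong (λ y → lookup y (i ↑ˡ n)) (f-++ a b)) (Vec.lookup-++ˡ b (h a) i)))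

    w₁ w₂ : Vec (Fin (n ℕ.+ n)) n
    w₁ = map (n ↑ʳ_) (allFin n)
    w₂ = map (_↑ˡ n) (allFin n)

    flip : Fin (n ℕ.+ n) → Fin (n ℕ.+ n)
    flip = join n n ∘ swap ∘ splitAt n

    flip-flip : ∀ i → flip (flip i) ≡ i
    flip-flip i = begin
      join n n (swap (splitAt n (flip i))) ≡⟨ cong (join n n ∘ swap) (Fin.splitAt-join n n (swap (splitAt n i))) ⟩
      join n n (swap (swap (splitAt n i))) ≡⟨ cong (join n n) (swap-involutive (splitAt n i)) ⟩
      join n n (splitAt n i)               ≡⟨ Fin.join-splitAt n n i ⟩
      i                                    ∎
      where open ≡-Reasoning

    lookup-w : ∀ i → lookup (w₁ ++ w₂) i ≡ flip i
    lookup-w i = trans (Vec.lookup-splitAt n w₁ w₂ i) (aux (splitAt n i))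
      where
      aux : ∀ s → [ lookup w₁ , lookup w₂ ]′ s ≡ join n n (swap s)
      aux (inj₁ j) = trans (Vec.lookup-map j _ (allFin n)) (cong (n ↑ʳ_) (Vec.lookup-allFin j))
      aux (inj₂ j) = trans (Vec.lookup-map j _ (allFin n)) (cong (_↑ˡ n) (Vec.lookup-allFin j))

    w-perm : IsPermutation (w₁ ++ w₂)
    w-perm =
        (λ {x} {y} eq → begin
          x             ≡⟨ flip-flip x ⟨
          flip (flip x) ≡⟨ cong flip (trans (sym (lookup-w x)) (trans eq (lookup-w y))) ⟩
          flip (flip y) ≡⟨ flip-flip y ⟩
          y             ∎)
      , strictlySurjective⇒surjective (λ y → flip y , trans (lookup-w (flip y)) (flip-flip y))
      where open ≡-Reasoning

  sequentializableWith-n : SequentializableWith h n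
  sequentializableWith-n = f , (w₁ ++ w₂ , w-perm) , λ x → begin
    take n ((f ^ʷ (w₁ ++ w₂)) x)
      ≡⟨ cong (λ y → take n ((f ^ʷ (w₁ ++ w₂)) y)) (Vec.take++drop≡id n x) ⟨
    take n ((f ^ʷ (w₁ ++ w₂)) (take n x ++ drop n x))
      ≡⟨ cong (take n) (^ʷ-++ f w₁ w₂ _) ⟩
    take n ((f ^ʷ w₂) ((f ^ʷ w₁) (take n x ++ drop n x)))
      ≡⟨ cong (λ y → take n ((f ^ʷ w₂) y)) (phase₁ (allFin n) _ _) ⟩
    take n ((f ^ʷ w₂) (take n x ++ assign (allFin n) (h (take n x)) (drop n x)))
      ≡⟨ cong (λ y → take n ((f ^ʷ w₂) (take n x ++ y))) (assign-all _ _) ⟩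
    take n ((f ^ʷ w₂) (take n x ++ h (take n x)))
      ≡⟨ cong (take n) (phase₂ (allFin n) _ _) ⟩
    take n (assign (allFin n) (h (take n x)) (take n x) ++ h (take n x))
      ≡⟨ take-++ _ _ ⟩
    assign (allFin n) (h (take n x)) (take n x)
      ≡⟨ assign-all _ _ ⟩
    h (take n x) ∎
    where open ≡-Reasoning

  -- Only the specification is meant to be used; abstract keeps the search
  -- from being unfolded.
  abstract
    κᵐⁱⁿ-exists : ∃ (IsLeast ℕ._≤_ (SequentializableWith h))
    κᵐⁱⁿ-exists = least (sequentializableWith? h) n sequentializableWith-n

  κᵐⁱⁿ : ℕ
  κᵐⁱⁿ = proj₁ κᵐⁱⁿ-exists

  κᵐⁱⁿ-isLeast : IsLeast ℕ._≤_ (SequentializableWith h) κᵐⁱⁿ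
  κᵐⁱⁿ-isLeast = proj₂ κᵐⁱⁿ-exists

κᵐⁱⁿ-mono : ∀ {n q} {g h : F n q} → g ≗ h → κᵐⁱⁿ h ℕ.≤ κᵐⁱⁿ g
κᵐⁱⁿ-mono {n} {g = g} {h} g≗h with f , w , s ← proj₁ (κᵐⁱⁿ-isLeast g) =
  proj₂ (κᵐⁱⁿ-isLeast h) _ (f , w , λ x → trans (s x) (g≗h (take n x)))

module _ (n q : ℕ) where

  IsκᵐⁱⁿValue : ℕ → Set
  IsκᵐⁱⁿValue k = ∃ λ (h : F n q) → κᵐⁱⁿ h ≡ k

  abstract
    κᵐⁱⁿ-max-exists : ∃ (IsGreatest ℕ._≤_ IsκᵐⁱⁿValue)
    κᵐⁱⁿ-max-exists = greatest
      (λ k → anyF? (λ g≗h eq → trans (ℕ.≤-antisym (κᵐⁱⁿ-mono g≗h) (κᵐⁱⁿ-mono (sym ∘ g≗h))) eq)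
                   (λ h → κᵐⁱⁿ h ℕ.≟ k))
      n
      (λ { k (h , refl) → proj₂ (κᵐⁱⁿ-isLeast h) n (sequentializableWith-n h) })
      (κᵐⁱⁿ {n} {q} (λ x → x) , (λ x → x) , refl)

  κᵐⁱⁿ-max : ℕ
  κᵐⁱⁿ-max = proj₁ κᵐⁱⁿ-max-exists

  κᵐⁱⁿ-max-isGreatest : IsGreatest ℕ._≤_ IsκᵐⁱⁿValue κᵐⁱⁿ-max
  κᵐⁱⁿ-max-isGreatest = proj₂ κᵐⁱⁿ-max-exists

-- The real number log_q n enters through its rational upper bounds: for
-- q ≥ 2, n ≥ 1 and b ≥ 1, log_q n ≤ a/b means n^b ≤ q^a, the factor q^a
-- being moved to the left when a is negative.
log[_]_≤_ : ℕ → ℕ → ℚᵘ → Set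
log[ q ] n ≤ mkℚᵘ (+ a)    b-1 = n ℕ.^ suc b-1 ℕ.≤ q ℕ.^ a
log[ q ] n ≤ mkℚᵘ -[1+ a ] b-1 = n ℕ.^ suc b-1 ℕ.* q ℕ.^ suc a ℕ.≤ 1

-- k ≤ n/2 − log_q n, rearranged so that the logarithm stands alone.
_≤n/2−log[_]_ : ℤ → ℕ → ℕ → Set
k ≤n/2−log[ q ] n = log[ q ] n ≤ ((+ n ℚᵘ./ 2) ℚᵘ.- (k ℚᵘ./ 1))

_Is⌊n/2−log[_]_⌋ : ℤ → ℕ → ℕ → Set
k Is⌊n/2−log[ q ] n ⌋ = IsGreatest ℤ._≤_ (_≤n/2−log[ q ] n) k

private
  n≤2^n : ∀ n → n ℕ.≤ 2 ℕ.^ n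
  n≤2^n zero    = z≤n
  n≤2^n (suc n) = ℕ.≤-trans (ℕ.+-mono-≤ (ℕ.m^n>0 2 n) (n≤2^n n))
    (ℕ.+-monoʳ-≤ (2 ℕ.^ n) (ℕ.m≤m+n (2 ℕ.^ n) 0))

  n²≤q^n : ∀ q n → 4 ℕ.≤ q → n ℕ.^ 2 ℕ.≤ q ℕ.^ n
  n²≤q^n q n 4≤q = begin
    n ℕ.^ 2           ≤⟨ ℕ.^-monoˡ-≤ 2 (n≤2^n n) ⟩
    (2 ℕ.^ n) ℕ.^ 2   ≡⟨ ℕ.^-*-assoc 2 n 2 ⟩
    2 ℕ.^ (n ℕ.* 2)   ≡⟨ cong (2 ℕ.^_) (ℕ.*-comm n 2) ⟩
    2 ℕ.^ (2 ℕ.* n)   ≡⟨ ℕ.^-*-assoc 2 2 n ⟨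
    4 ℕ.^ n           ≤⟨ ℕ.^-monoˡ-≤ n 4≤q ⟩
    q ℕ.^ n           ∎
    where open ℕ.≤-Reasoning

  log? : ∀ q n p → Dec (log[ q ] n ≤ p)
  log? q n (mkℚᵘ (+ a)    d) = _ ℕ.≤? _
  log? q n (mkℚᵘ -[1+ a ] d) = _ ℕ.≤? _

  bounded : ∀ q n → 4 ℕ.≤ q → 1 ℕ.≤ n → ∀ j → (+ j) ≤n/2−log[ q ] n → j ℕ.≤ n
  bounded q n 4≤q 1≤n j = aux (+ n ℤ.* + 1 ℤ.+ (ℤ.- + j) ℤ.* + 2) refl
    where
    aux : ∀ z → + n ℤ.* + 1 ℤ.+ (ℤ.- + j) ℤ.* + 2 ≡ z → log[ q ] n ≤ mkℚᵘ z 1 → j ℕ.≤ n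
    aux (+ a) eq _ = ℕ.≤-trans (ℕ.m≤m*n j 2)
      (ℕ.≤-trans (ℕ.m≤n+m (j ℕ.* 2) a) (ℕ.≤-reflexive (ℤ.+-injective (sym n≡))))
      where
      open ≡-Reasoning
      n≡ : + n ≡ + (a ℕ.+ j ℕ.* 2)
      n≡ = begin
        + n                                              ≡⟨ ℤ.+-identityʳ (+ n) ⟨
        + n ℤ.+ + 0                                      ≡⟨ cong (λ z → + n ℤ.+ z) (ℤ.+-inverseˡ (+ j ℤ.* + 2)) ⟨
        + n ℤ.+ (ℤ.- (+ j ℤ.* + 2) ℤ.+ + j ℤ.* + 2)      ≡⟨ ℤ.+-assoc (+ n) (ℤ.- (+ j ℤ.* + 2)) (+ j ℤ.* + 2) ⟨
        + n ℤ.+ ℤ.- (+ j ℤ.* + 2) ℤ.+ + j ℤ.* + 2        ≡⟨ cong (ℤ._+ + j ℤ.* + 2) (cong₂ ℤ._+_ {u = ℤ.- (+ j ℤ.* + 2)} (sym (ℤ.*-identityʳ (+ n))) (ℤ.neg-distribˡ-* (+ j) (+ 2))) ⟩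
        + n ℤ.* + 1 ℤ.+ (ℤ.- + j) ℤ.* + 2 ℤ.+ + j ℤ.* + 2 ≡⟨ cong (ℤ._+ + j ℤ.* + 2) eq ⟩
        + a ℤ.+ + j ℤ.* + 2                              ≡⟨ cong (λ z → + a ℤ.+ z) (ℤ.pos-* j 2) ⟨
        + a ℤ.+ + (j ℕ.* 2)                              ∎
    aux -[1+ a ] _ le = contradiction le (ℕ.<⇒≱ (begin-strict
      1                            <⟨ s≤s (s≤s z≤n) ⟩
      4                            ≤⟨ 4≤q ⟩
      q                            ≡⟨ ℕ.*-identityʳ q ⟨
      q ℕ.^ 1                      ≤⟨ ℕ.^-monoʳ-≤ q ⦃ ℕ.>-nonZero (ℕ.<-≤-trans (s≤s z≤n) 4≤q) ⦄ {1} {suc a} (s≤s z≤n) ⟩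
      q ℕ.^ suc a                  ≡⟨ ℕ.*-identityˡ _ ⟨
      1 ℕ.* q ℕ.^ suc a            ≤⟨ ℕ.*-monoˡ-≤ (q ℕ.^ suc a) (ℕ.^-monoˡ-≤ 2 1≤n) ⟩
      n ℕ.^ 2 ℕ.* q ℕ.^ suc a      ∎))
      where open ℕ.≤-Reasoning

  zero-ok : ∀ q n → 4 ℕ.≤ q → (+ 0) ≤n/2−log[ q ] n
  zero-ok q n 4≤q = subst (λ z → log[ q ] n ≤ mkℚᵘ z 1)
    (sym (trans (ℤ.+-identityʳ (+ n ℤ.* + 1)) (ℤ.*-identityʳ (+ n)))) (n²≤q^n q n 4≤q)

⌊n/2−log⌋-exists : ∀ q n → 4 ℕ.≤ q → 1 ℕ.≤ n → ∃ (_Is⌊n/2−log[ q ] n ⌋)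
⌊n/2−log⌋-exists q n 4≤q 1≤n
  with j , pj , max ← greatest (λ j → log? q n ((+ n ℚᵘ./ 2) ℚᵘ.- (+ j ℚᵘ./ 1)))
                               n (bounded q n 4≤q 1≤n) (0 , zero-ok q n 4≤q)
  = + j , pj , λ { (+ i) pi → ℤ.+≤+ (max i pi) ; -[1+ i ] _ → ℤ.-≤+ }

{-# OPTIONS --safe #-}
-- In fact κᵐⁱⁿ-max n q ≥ K whenever 2K ≤ n. Cut a sequentializing word at
-- the moment when exactly K of the n original coordinates have been updated, and
-- let S be the set of these. The original part of the current state is given by
-- h(x) on S and by x off S, so if q^(K-1) + 1 states x agree off S, have images
-- agreeing on S, and have distinct images, then fewer than K additional
-- coordinates cannot tell them apart. A map h with such states for every S of
-- size K is built greedily: each S uses only q^(K-1) + 1 ≤ q^K / 2 states of a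
-- common cylinder {x : x agrees with b off S}. There are at most 2^n ≤ q^(n-K)
-- sets S, so among the q^(n-K) cylinders some one contains at most q^(K-1)
-- states used for previous sets, which leaves enough unused ones.
module Submission where

open import Defs
open import Data.Fin.Base using (Fin; zero; suc; _↑ˡ_; _↑ʳ_; splitAt; combine; fromℕ<; inject≤; punchIn; funToFin; finToFun)
import Data.Fin.Properties as Fin
open import Data.Fin.Subset using (Subset; inside; outside; ∣_∣; ∁; ⊥; ⊤; _∪_; ⁅_⁆; _∈_; _∉_)
import Data.Fin.Subset.Properties as Subset
open import Data.Integer.Base using (ℤ; +_; -[1+_]; _≤_; -≤+; +≤+)
import Data.Integer.Base as ℤ
import Data.Integer.Properties as ℤ
open import Data.List.Base as List using (List; []; _∷_; length; filter)
import Data.List.Properties as List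
open import Data.List.Membership.Propositional using () renaming (_∈_ to _∈ˡ_; _∉_ to _∉ˡ_)
import Data.List.Membership.Propositional.Properties as List
open import Data.List.Relation.Unary.Any using (here; there)
open import Data.Nat.Base using (ℕ)
import Data.Nat.Base as ℕ
import Data.Nat.Properties as ℕ
open import Data.Product.Base using (∃; _×_; _,_; proj₁; proj₂)
open import Data.Rational.Unnormalised.Base using (mkℚᵘ)
open import Data.Sum.Base using (inj₁; inj₂)
open import Data.Vec.Base using (Vec; []; _∷_; _++_; lookup; take; drop; replicate; here; there)
import Data.Vec.Properties as Vec
open import Data.Vec.Membership.Propositional using () renaming (_∈_ to _∈ᵛ_; _∉_ to _∉ᵛ_)
import Data.Vec.Membership.Propositional.Properties as Vec
import Data.Vec.Relation.Unary.Any as VecAny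
import Data.Vec.Relation.Unary.All as VecAll
open import Data.Vec.Relation.Unary.AllPairs using ([]; _∷_)
open import Data.Vec.Relation.Unary.Unique.Propositional using (Unique)
import Data.Vec.Relation.Unary.Unique.Propositional.Properties as Unique
open import Function.Base using (_∘_)
open import Function.Definitions using (Injective)
open import Relation.Binary.Definitions using (DecidableEquality)
open import Relation.Binary.PropositionalEquality
open import Relation.Nullary.Decidable using (yes; no; ¬?)
open import Relation.Nullary.Negation using (¬_; contradiction)
open import Relation.Unary using (Decidable)

-- Counting

filter-complement : ∀ {A : Set} {P : A → Set} (P? : Decidable P) xs →
  length (filter P? xs) ℕ.+ length (filter (¬? ∘ P?) xs) ≡ length xs
filter-complement P? []       = refl
filter-complement P? (x ∷ xs) with P? x
... | yes _ = cong ℕ.suc (filter-complement P? xs)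
... | no  _ = trans (ℕ.+-suc _ _) (cong ℕ.suc (filter-complement P? xs))

-- Pigeonhole by peeling off one value at a time: a fibre holding at least `m` entries of `P` uses
-- up `m` of the budget `s * m`, so not all `s` fibres can be that full.
sparse-fibre : ∀ {A B : Set} → DecidableEquality B → (g : A → B) →
  ∀ m {s} (β : Fin s → B) → Injective _≡_ _≡_ β →
  ∀ P → length P ℕ.< s ℕ.* m →
  ∃ λ b → ∃ λ Q → length Q ℕ.< m × (∀ {x} → x ∈ˡ P → g x ≡ β b → x ∈ˡ Q)
sparse-fibre _≟_ g m {ℕ.suc s} β β-inj P P<
  with length (filter ((_≟ β zero) ∘ g) P) ℕ.<? m
... | yes Q<m = zero , _ , Q<m , List.∈-filter⁺ ((_≟ β zero) ∘ g)
... | no  Q≮m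
  with b , Q , Q<m , fibre ← sparse-fibre _≟_ g m (β ∘ suc) (Fin.suc-injective ∘ β-inj)
         (filter (¬? ∘ (_≟ β zero) ∘ g) P)
         (ℕ.+-cancelˡ-< m _ _ (let open ℕ.≤-Reasoning in begin-strict
           m ℕ.+ length (filter (¬? ∘ (_≟ β zero) ∘ g) P)
             ≤⟨ ℕ.+-monoˡ-≤ _ (ℕ.≮⇒≥ Q≮m) ⟩
           length (filter ((_≟ β zero) ∘ g) P) ℕ.+ length (filter (¬? ∘ (_≟ β zero) ∘ g) P)
             ≡⟨ filter-complement ((_≟ β zero) ∘ g) P ⟩
           length P
             <⟨ P< ⟩
           m ℕ.+ s ℕ.* m ∎))
  = suc b , Q , Q<m , λ x∈P gx≡ → fibre
        (List.∈-filter⁺ (¬? ∘ (_≟ β zero) ∘ g) x∈P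
          -- Points over a later value survive the removal of the fibre over `β zero`, because `β`
          -- is injective.
          (λ gx≡′ → Fin.0≢1+n (β-inj (trans (sym gx≡′) gx≡))))
        gx≡

-- Since `u` is injective, each entry of `Q` rules out at most one of the `s` indices.
avoiding : ∀ {A : Set} → DecidableEquality A →
  ∀ {s} (u : Fin s → A) → Injective _≡_ _≡_ u →
  ∀ m (Q : List A) → length Q ℕ.+ m ℕ.≤ s →
  ∃ λ (σ : Fin m → Fin s) → Injective _≡_ _≡_ σ × (∀ j → u (σ j) ∉ˡ Q)
avoiding _≟_ u u-inj m [] m≤s =
  (λ j → inject≤ j m≤s) , Fin.inject≤-injective m≤s m≤s _ _ , λ _ ()
avoiding _≟_ {ℕ.suc s} u u-inj m (y ∷ Q) (ℕ.s≤s Q+m≤s)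
  with Fin.any? (λ i → u i ≟ y)
... | yes (i , ui≡y)
  with σ , σ-inj , free ← avoiding _≟_ (u ∘ punchIn i)
         (Fin.punchIn-injective i _ _ ∘ u-inj) m Q Q+m≤s
  = punchIn i ∘ σ , σ-inj ∘ Fin.punchIn-injective i _ _ , λ
      { j (here eq)  → Fin.punchInᵢ≢i i (σ j) (u-inj (trans eq (sym ui≡y)))
      ; j (there ∈Q) → free j ∈Q }
avoiding _≟_ {ℕ.suc s} u u-inj m (y ∷ Q) (ℕ.s≤s Q+m≤s) | no ¬hit
  -- Here `y` rules out no index; `zero` is given up all the same, so that the number of indices
  -- drops in step with the length of the list.
  with σ , σ-inj , free ← avoiding _≟_ (u ∘ suc) (Fin.suc-injective ∘ u-inj) m Q Q+m≤s
  = suc ∘ σ , σ-inj ∘ Fin.suc-injective , λ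
      { j (here eq)  → ¬hit (suc (σ j) , eq)
      ; j (there ∈Q) → free j ∈Q }

subsets : ∀ n → List (Subset n)
subsets ℕ.zero    = [] ∷ []
subsets (ℕ.suc n) = List.map (inside ∷_) (subsets n) List.++ List.map (outside ∷_) (subsets n)

∈-subsets : ∀ {n} (S : Subset n) → S ∈ˡ subsets n
∈-subsets []            = here refl
∈-subsets (inside ∷ S)  = List.∈-++⁺ˡ (List.∈-map⁺ _ (∈-subsets S))
∈-subsets (outside ∷ S) = List.∈-++⁺ʳ _ (List.∈-map⁺ _ (∈-subsets S))

length-subsets : ∀ n → length (subsets n) ≡ 2 ℕ.^ n
length-subsets ℕ.zero    = refl
length-subsets (ℕ.suc n) = begin
  length (List.map (inside ∷_) (subsets n) List.++ List.map (outside ∷_) (subsets n))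
    ≡⟨ List.length-++ (List.map (inside ∷_) (subsets n)) ⟩
  length (List.map (inside ∷_) (subsets n)) ℕ.+ length (List.map (outside ∷_) (subsets n))
    ≡⟨ cong₂ ℕ._+_ (List.length-map _ (subsets n)) (List.length-map _ (subsets n)) ⟩
  length (subsets n) ℕ.+ length (subsets n)
    ≡⟨ cong₂ ℕ._+_ (length-subsets n) (length-subsets n) ⟩
  2 ℕ.^ n ℕ.+ 2 ℕ.^ n
    ≡⟨ cong (2 ℕ.^ n ℕ.+_) (ℕ.+-identityʳ (2 ℕ.^ n)) ⟨
  2 ℕ.* 2 ℕ.^ n ∎
  where open ≡-Reasoning

∣p∪⁅x⁆∣≤1+∣p∣ : ∀ {n} (p : Subset n) x → ∣ p ∪ ⁅ x ⁆ ∣ ℕ.≤ ℕ.suc ∣ p ∣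
∣p∪⁅x⁆∣≤1+∣p∣ (inside ∷ p) zero rewrite Subset.∪-identityʳ p = ℕ.n≤1+n _
∣p∪⁅x⁆∣≤1+∣p∣ (outside ∷ p) zero rewrite Subset.∪-identityʳ p = ℕ.≤-refl
∣p∪⁅x⁆∣≤1+∣p∣ (inside ∷ p)  (suc x) = ℕ.s≤s (∣p∪⁅x⁆∣≤1+∣p∣ p x)
∣p∪⁅x⁆∣≤1+∣p∣ (outside ∷ p) (suc x) = ∣p∪⁅x⁆∣≤1+∣p∣ p x

-- Cylinders

decV-injective : ∀ {n q} → Injective _≡_ _≡_ (decV {n} {q})
decV-injective {n} {q} {i} {j} eq = begin
  i                              ≡⟨ Fin.funToFin-finToFin {n} {q} i ⟨
  funToFin (finToFun {q} {n} i)  ≡⟨ funToFin-cong (λ l → begin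
    finToFun {q} {n} i l               ≡⟨ Vec.lookup∘tabulate _ l ⟨
    lookup (decV {n} {q} i) l          ≡⟨ cong (λ v → lookup v l) eq ⟩
    lookup (decV {n} {q} j) l          ≡⟨ Vec.lookup∘tabulate _ l ⟩
    finToFun {q} {n} j l               ∎) ⟩
  funToFin (finToFun {q} {n} j)  ≡⟨ Fin.funToFin-finToFin {n} {q} j ⟩
  j                              ∎
  where
  open ≡-Reasoning
  funToFin-cong : ∀ {a b} {f g : Fin a → Fin b} → f ≗ g → funToFin f ≡ funToFin g
  funToFin-cong {ℕ.zero}  f≗g = refl
  funToFin-cong {ℕ.suc a} f≗g = cong₂ combine (f≗g zero) (funToFin-cong (f≗g ∘ suc))

-- Cylinders are the fibres of `outer S`: fixing `b` and varying `a` runs through one of them, while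
-- fixing `a` and varying `b` keeps the entries on `S` constant.
merge : ∀ {A : Set} {n} (S : Subset n) → Vec A ∣ S ∣ → Vec A ∣ ∁ S ∣ → Vec A n
merge []            a       b       = []
merge (inside ∷ S)  (x ∷ a) b       = x ∷ merge S a b
merge (outside ∷ S) a       (x ∷ b) = x ∷ merge S a b

inner : ∀ {A : Set} {n} (S : Subset n) → Vec A n → Vec A ∣ S ∣
inner []            []      = []
inner (inside ∷ S)  (x ∷ v) = x ∷ inner S v
inner (outside ∷ S) (x ∷ v) = inner S v

outer : ∀ {A : Set} {n} (S : Subset n) → Vec A n → Vec A ∣ ∁ S ∣
outer []            []      = []
outer (inside ∷ S)  (x ∷ v) = outer S v
outer (outside ∷ S) (x ∷ v) = x ∷ outer S v

inner-merge : ∀ {A : Set} {n} (S : Subset n) (a : Vec A ∣ S ∣) b → inner S (merge S a b) ≡ a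
inner-merge []            []      b       = refl
inner-merge (inside ∷ S)  (x ∷ a) b       = cong (x ∷_) (inner-merge S a b)
inner-merge (outside ∷ S) a       (x ∷ b) = inner-merge S a b

outer-merge : ∀ {A : Set} {n} (S : Subset n) (a : Vec A ∣ S ∣) b → outer S (merge S a b) ≡ b
outer-merge []            a       []      = refl
outer-merge (inside ∷ S)  (x ∷ a) b       = outer-merge S a b
outer-merge (outside ∷ S) a       (x ∷ b) = cong (x ∷_) (outer-merge S a b)

merge-outside : ∀ {A : Set} {n} (S : Subset n) {a a′ : Vec A ∣ S ∣} {b} l → l ∉ S →
  lookup (merge S a b) l ≡ lookup (merge S a′ b) l
merge-outside (inside ∷ S)                  zero    l∉S = contradiction here l∉S
merge-outside (inside ∷ S)  {_ ∷ _} {_ ∷ _} (suc l) l∉S = merge-outside S l (l∉S ∘ there)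
merge-outside (outside ∷ S) {b = _ ∷ _}     zero    l∉S = refl
merge-outside (outside ∷ S) {b = _ ∷ _}     (suc l) l∉S = merge-outside S l (l∉S ∘ there)

merge-inside : ∀ {A : Set} {n} (S : Subset n) {a : Vec A ∣ S ∣} {b b′} l → l ∈ S →
  lookup (merge S a b) l ≡ lookup (merge S a b′) l
merge-inside (inside ∷ S)  {_ ∷ _}                  zero    l∈S         = refl
merge-inside (inside ∷ S)  {_ ∷ _}                  (suc l) (there l∈S) = merge-inside S l l∈S
merge-inside (outside ∷ S) {b = _ ∷ _} {b′ = _ ∷ _} (suc l) (there l∈S) = merge-inside S l l∈S

_≟ˢ_ : ∀ {n q} → DecidableEquality (State n q)
_≟ˢ_ = Vec.≡-dec Fin._≟_

free-points : ∀ {n q} (S : Subset n) (P : List (State n q)) m →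
  m ℕ.+ m ℕ.≤ q ℕ.^ ∣ S ∣ → length P ℕ.< q ℕ.^ ∣ ∁ S ∣ ℕ.* m →
  ∃ λ (x : Fin m → State n q) → Injective _≡_ _≡_ x × (∀ j → x j ∉ˡ P) ×
    (∀ i j l → l ∉ S → lookup (x i) l ≡ lookup (x j) l)
free-points {n} {q} S P m 2m≤ P<
  with b , Q , Q<m , fibre ← sparse-fibre _≟ˢ_ (outer S) m decV decV-injective P P<
  with σ , σ-inj , free ← avoiding _≟ˢ_ (λ i → merge S (decV i) (decV b))
         (λ {i} {j} eq → decV-injective (trans (sym (inner-merge S (decV i) (decV b)))
                           (trans (cong (inner S) eq) (inner-merge S (decV j) (decV b)))))
         m Q (ℕ.≤-trans (ℕ.+-monoˡ-≤ m (ℕ.<⇒≤ Q<m)) 2m≤)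
  = (λ j → merge S (decV (σ j)) (decV b))
  , (λ {i} {j} eq → σ-inj (decV-injective (trans (sym (inner-merge S (decV (σ i)) (decV b)))
                      (trans (cong (inner S) eq) (inner-merge S (decV (σ j)) (decV b))))))
  -- Only the states of `P` in the chosen cylinder matter, and all of these are listed in `Q`.
  , (λ j x∈P → free j (fibre x∈P (outer-merge S _ _)))
  , λ i j l l∉S → merge-outside S l l∉S

-- Confusable states

record Confusable {n q m} (S : Subset n) (h : F n q) (x : Fin m → State n q) : Set where
  field
    agree-outside : ∀ i j l → l ∉ S → lookup (x i) l ≡ lookup (x j) l
    agree-inside  : ∀ i j l → l ∈ S → lookup (h (x i)) l ≡ lookup (h (x j)) l
    distinct      : Injective _≡_ _≡_ (h ∘ x)

-- Confusability sees the map only at the points `x j`, so it survives any later change of the map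
-- elsewhere.
Confusable-cong : ∀ {n q m} {S : Subset n} {g h : F n q} {x : Fin m → State n q} →
  (∀ j → h (x j) ≡ g (x j)) → Confusable S g x → Confusable S h x
Confusable-cong h≡g c = record
  { agree-outside = agree-outside
  ; agree-inside  = λ i j l l∈S → trans (cong (λ v → lookup v l) (h≡g i))
      (trans (agree-inside i j l l∈S) (cong (λ v → lookup v l) (sym (h≡g j))))
  ; distinct      = λ {i} {j} eq → distinct (trans (sym (h≡g i)) (trans eq (h≡g j)))
  }
  where open Confusable c

-- Greedy construction of a confusing map

override : ∀ {n q m} (x y : Fin m → State n q) → F n q → F n q
override x y h z with Fin.any? (λ j → x j ≟ˢ z)
... | yes (j , _) = y j
... | no  _       = h z

override-hit : ∀ {n q m} (x y : Fin m → State n q) h → Injective _≡_ _≡_ x →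
  ∀ j → override x y h (x j) ≡ y j
override-hit x y h x-inj j with Fin.any? (λ i → x i ≟ˢ x j)
... | yes (i , eq) = cong y (x-inj eq)
... | no  ¬hit     = contradiction (j , refl) ¬hit

override-miss : ∀ {n q m} (x y : Fin m → State n q) h {z} → (∀ j → x j ≢ z) →
  override x y h z ≡ h z
override-miss x y h {z} miss with Fin.any? (λ j → x j ≟ˢ z)
... | yes (j , eq) = contradiction eq (miss j)
... | no  _        = refl

-- The constant letter `o` on `S` makes the images agree there; they are told apart by their entries
-- off `S`, which allow `q ^ ∣ ∁ S ∣` choices.
images : ∀ {n q} (S : Subset n) m → Fin q → m ℕ.≤ q ℕ.^ ∣ ∁ S ∣ →
  ∃ λ (y : Fin m → State n q) → Injective _≡_ _≡_ y ×
    (∀ i j l → l ∈ S → lookup (y i) l ≡ lookup (y j) l)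
images S m o m≤ =
    (λ j → merge S (replicate _ o) (decV (inject≤ j m≤)))
  , (λ {i} {j} eq → Fin.inject≤-injective m≤ m≤ i j (decV-injective
      (trans (sym (outer-merge S (replicate _ o) _))
        (trans (cong (outer S) eq) (outer-merge S (replicate _ o) _)))))
  , λ i j l l∈S → merge-inside S l l∈S

-- `P` collects all states whose images have been prescribed. Its length bound leaves room for the
-- next set; its containing every chosen tuple protects these tuples, as new states are taken
-- outside `P`.
greedy : ∀ {n q} K m → Fin q →
  (∀ (S : Subset n) → ∣ S ∣ ≡ K →
    m ℕ.+ m ℕ.≤ q ℕ.^ ∣ S ∣ × m ℕ.≤ q ℕ.^ ∣ ∁ S ∣ × 2 ℕ.^ n ℕ.≤ q ℕ.^ ∣ ∁ S ∣) → 0 ℕ.< m →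
  (L : List (Subset n)) → length L ℕ.≤ 2 ℕ.^ n →
  ∃ λ (h : F n q) → ∃ λ (P : List (State n q)) → length P ℕ.≤ length L ℕ.* m ×
    (∀ {S} → S ∈ˡ L → ∣ S ∣ ≡ K → ∃ λ (x : Fin m → State n q) → (∀ j → x j ∈ˡ P) × Confusable S h x)
greedy K m o bounds 0<m [] L≤ = (λ x → x) , [] , ℕ.z≤n , λ ()
greedy {n} {q} K m o bounds 0<m (S ∷ L) L<
  with h , P , P≤ , confused ← greedy K m o bounds 0<m L (ℕ.<⇒≤ L<)
  with ∣ S ∣ ℕ.≟ K
... | no ∣S∣≢K = h , P , ℕ.≤-trans P≤ (ℕ.m≤n+m _ m) , λ
      { (here refl) ∣S∣≡K → contradiction ∣S∣≡K ∣S∣≢K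
      ; (there T∈L) → confused T∈L }
... | yes ∣S∣≡K
  with 2m≤ , m≤ , 2^n≤ ← bounds S ∣S∣≡K
  with y , y-inj , y-inside ← images S m o m≤
  with x , x-inj , x-free , x-outside ← free-points S P m 2m≤ (let open ℕ.≤-Reasoning in begin-strict
         length P               ≤⟨ P≤ ⟩
         -- Strict because `S` itself also counts among the at most `2 ^ n` sets.
         length L ℕ.* m         <⟨ ℕ.*-monoˡ-< m ⦃ ℕ.>-nonZero 0<m ⦄ (ℕ.<-≤-trans L< 2^n≤) ⟩
         q ℕ.^ ∣ ∁ S ∣ ℕ.* m    ∎)
  = override x y h , List.tabulate x List.++ P
  , (begin
      length (List.tabulate x List.++ P)           ≡⟨ List.length-++ (List.tabulate x) ⟩
      length (List.tabulate x) ℕ.+ length P        ≡⟨ cong (ℕ._+ length P) (List.length-tabulate x) ⟩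
      m ℕ.+ length P                               ≤⟨ ℕ.+-monoʳ-≤ m P≤ ⟩
      m ℕ.+ length L ℕ.* m                         ∎)
  , λ
  { (here refl) _ → x , List.∈-++⁺ˡ ∘ List.∈-tabulate⁺ , record
      { agree-outside = x-outside
      ; agree-inside  = λ i j l l∈S → trans (cong (λ v → lookup v l) (override-hit x y h x-inj i))
          (trans (y-inside i j l l∈S) (cong (λ v → lookup v l) (sym (override-hit x y h x-inj j))))
      ; distinct      = λ {i} {j} eq → y-inj (trans (sym (override-hit x y h x-inj i))
          (trans eq (override-hit x y h x-inj j)))
      }
  -- The tuple of an earlier set lies in `P`, which the new states avoid, so the override does not
  -- touch it.
  ; (there T∈L) ∣T∣≡K → let z , z∈P , c = confused T∈L ∣T∣≡K in
      z , List.∈-++⁺ʳ _ ∘ z∈P ,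
      Confusable-cong (λ j → override-miss x y h λ i xi≡zj →
        x-free i (subst (_∈ˡ P) (sym xi≡zj) (z∈P j))) c }
  where open ℕ.≤-Reasoning

-- A letter from an alphabet of size at least 4 is worth two binary choices.
2^n≤q^m : ∀ {q n m} → 4 ℕ.≤ q → n ℕ.≤ 2 ℕ.* m → 2 ℕ.^ n ℕ.≤ q ℕ.^ m
2^n≤q^m {q} {n} {m} 4≤q n≤2m = begin
  2 ℕ.^ n           ≤⟨ ℕ.^-monoʳ-≤ 2 n≤2m ⟩
  2 ℕ.^ (2 ℕ.* m)   ≡⟨ ℕ.^-*-assoc 2 2 m ⟨
  4 ℕ.^ m           ≤⟨ ℕ.^-monoˡ-≤ m 4≤q ⟩
  q ℕ.^ m           ∎
  where open ℕ.≤-Reasoning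

-- For `K = suc k`, the hypothesis gives `K ≤ n ∸ K`. So the complement of a `K`-set has room for
-- the distinct images and yields as many cylinders as there are subsets.
confusing-map : ∀ {n q} k → 4 ℕ.≤ q → 2 ℕ.* ℕ.suc k ℕ.≤ n →
  ∃ λ (h : F n q) → ∀ S → ∣ S ∣ ≡ ℕ.suc k →
    ∃ λ (x : Fin (ℕ.suc (q ℕ.^ k)) → State n q) → Confusable S h x
confusing-map {n} {q} k 4≤q 2K≤n
  -- The tuples have one state more than `k` additional coordinates have values.
  = let h , P , _ , confused = greedy (ℕ.suc k) (ℕ.suc (q ℕ.^ k))
          (fromℕ< (ℕ.<-≤-trans (ℕ.s≤s ℕ.z≤n) 4≤q)) bounds (ℕ.s≤s ℕ.z≤n)
          (subsets n) (ℕ.≤-reflexive (length-subsets n))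
    in h , λ S ∣S∣≡K → let x , _ , c = confused (∈-subsets S) ∣S∣≡K in x , c
  where
  open ℕ.≤-Reasoning
  instance
    _ : ℕ.NonZero q
    _ = ℕ.>-nonZero (ℕ.<-≤-trans (ℕ.s≤s ℕ.z≤n) 4≤q)

  -- As `1 ≤ q ^ k`, the left side is at most `4 * q ^ k`, and one more factor `q` absorbs the 4.
  2m≤q^K : ℕ.suc (q ℕ.^ k) ℕ.+ ℕ.suc (q ℕ.^ k) ℕ.≤ q ℕ.^ ℕ.suc k
  2m≤q^K = begin
    ℕ.suc (q ℕ.^ k) ℕ.+ ℕ.suc (q ℕ.^ k)                    ≤⟨ ℕ.+-mono-≤ m≤ m≤ ⟩
    2 ℕ.* q ℕ.^ k ℕ.+ 2 ℕ.* q ℕ.^ k                        ≡⟨ ℕ.*-distribʳ-+ (q ℕ.^ k) 2 2 ⟨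
    4 ℕ.* q ℕ.^ k                                          ≤⟨ ℕ.*-monoˡ-≤ (q ℕ.^ k) 4≤q ⟩
    q ℕ.^ ℕ.suc k                                          ∎
    where
    m≤ : ℕ.suc (q ℕ.^ k) ℕ.≤ 2 ℕ.* q ℕ.^ k
    m≤ = ℕ.+-mono-≤ (ℕ.m^n>0 q k) (ℕ.m≤m+n (q ℕ.^ k) 0)

  bounds : ∀ (S : Subset n) → ∣ S ∣ ≡ ℕ.suc k →
    ℕ.suc (q ℕ.^ k) ℕ.+ ℕ.suc (q ℕ.^ k) ℕ.≤ q ℕ.^ ∣ S ∣ ×
    ℕ.suc (q ℕ.^ k) ℕ.≤ q ℕ.^ ∣ ∁ S ∣ × 2 ℕ.^ n ℕ.≤ q ℕ.^ ∣ ∁ S ∣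
  bounds S ∣S∣≡K rewrite Subset.∣∁p∣≡n∸∣p∣ S | ∣S∣≡K =
      2m≤q^K
    , (begin
        ℕ.suc (q ℕ.^ k)                      ≤⟨ ℕ.m≤m+n _ _ ⟩
        ℕ.suc (q ℕ.^ k) ℕ.+ ℕ.suc (q ℕ.^ k)  ≤⟨ 2m≤q^K ⟩
        q ℕ.^ ℕ.suc k                        ≤⟨ ℕ.^-monoʳ-≤ q K≤n∸K ⟩
        q ℕ.^ (n ℕ.∸ ℕ.suc k)                ∎)
    , 2^n≤q^m {m = n ℕ.∸ ℕ.suc k} 4≤q (begin
        n                                              ≡⟨ ℕ.m+[n∸m]≡n (ℕ.≤-trans (ℕ.m≤m+n (ℕ.suc k) _) 2K≤n) ⟨
        ℕ.suc k ℕ.+ (n ℕ.∸ ℕ.suc k)                    ≤⟨ ℕ.+-monoˡ-≤ _ K≤n∸K ⟩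
        (n ℕ.∸ ℕ.suc k) ℕ.+ (n ℕ.∸ ℕ.suc k)            ≡⟨ cong ((n ℕ.∸ ℕ.suc k) ℕ.+_) (ℕ.+-identityʳ _) ⟨
        2 ℕ.* (n ℕ.∸ ℕ.suc k)                          ∎)
    where
    K≤n∸K : ℕ.suc k ℕ.≤ n ℕ.∸ ℕ.suc k
    K≤n∸K = ℕ.m+n≤o⇒m≤o∸n (ℕ.suc k) (begin
      ℕ.suc k ℕ.+ ℕ.suc k ≡⟨ cong (ℕ.suc k ℕ.+_) (ℕ.+-identityʳ (ℕ.suc k)) ⟨
      2 ℕ.* ℕ.suc k       ≤⟨ 2K≤n ⟩
      n                   ∎)

-- Cutting a sequentializing word

lookup-ext : ∀ {A : Set} {n} {u v : Vec A n} → (∀ l → lookup u l ≡ lookup v l) → u ≡ v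
lookup-ext {u = u} {v} eq =
  trans (sym (Vec.tabulate∘lookup u)) (trans (Vec.tabulate-cong eq) (Vec.tabulate∘lookup v))

lookup-take : ∀ {A : Set} {n k} (v : Vec A (n ℕ.+ k)) l → lookup (take n v) l ≡ lookup v (l ↑ˡ k)
lookup-take {n = n} {k} v l = begin
  lookup (take n v) l                      ≡⟨ Vec.lookup-++ˡ (take n v) (drop n v) l ⟨
  lookup (take n v ++ drop n v) (l ↑ˡ k)   ≡⟨ cong (λ u → lookup u (l ↑ˡ k)) (Vec.take++drop≡id n v) ⟩
  lookup v (l ↑ˡ k)                        ∎
  where open ≡-Reasoning

^ʷ-untouched : ∀ {m q t} (f : F m q) (v : Vec (Fin m) t) y {j} → j ∉ᵛ v →
  lookup ((f ^ʷ v) y) j ≡ lookup y j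
^ʷ-untouched f []      y j∉v = refl
^ʷ-untouched f (i ∷ v) y j∉v =
  trans (^ʷ-untouched f v _ (j∉v ∘ VecAny.there))
        (Vec.lookup∘update′ (j∉v ∘ VecAny.here) y _)

-- The part of the word already run is kept only as its effect `current`, the remaining part only as
-- `finish`. Counting states at the cut needs no more of the word.
record Cut {n q} (h : F n q) (K k : ℕ) : Set where
  field
    updated           : Subset n
    ∣updated∣         : ∣ updated ∣ ≡ K
    current           : State n q → State (n ℕ.+ k) q
    finish            : State (n ℕ.+ k) q → State n q
    finish-current    : ∀ x → finish (current x) ≡ h x
    lookup-updated    : ∀ x l → l ∈ updated → lookup (current x) (l ↑ˡ k) ≡ lookup (h x) l
    lookup-notUpdated : ∀ x l → l ∉ updated → lookup (current x) (l ↑ˡ k) ≡ lookup x l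

module _ {n q k : ℕ} (f : F (n ℕ.+ k) q) (h : F n q) {K : ℕ} (K≤n : K ℕ.≤ n) where

  -- v is the rest of the word; S consists of the original coordinates not in v.
  cut-from : ∀ {t} (v : Vec (Fin (n ℕ.+ k)) t) (S : Subset n) (st : State n q → State (n ℕ.+ k) q) →
    Unique v → ∣ S ∣ ℕ.≤ K →
    (∀ l → l ∈ S → l ↑ˡ k ∉ᵛ v) → (∀ l → l ∉ S → l ↑ˡ k ∈ᵛ v) →
    (∀ x → take n ((f ^ʷ v) (st x)) ≡ h x) →
    (∀ x l → l ∉ S → lookup (st x) (l ↑ˡ k) ≡ lookup x l) →
    Cut h K k
  cut-from v S st v-uniq ∣S∣≤K ∉v ∈v fin keep with ∣ S ∣ ℕ.≟ K
  ... | yes ∣S∣≡K = record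
    { updated           = S
    ; ∣updated∣         = ∣S∣≡K
    ; current           = st
    ; finish            = take n ∘ (f ^ʷ v)
    ; finish-current    = fin
    -- A coordinate absent from the rest of the word already has its final value, which is that of
    -- `h x`.
    ; lookup-updated    = λ x l l∈S → begin
        lookup (st x) (l ↑ˡ k)               ≡⟨ ^ʷ-untouched f v (st x) (∉v l l∈S) ⟨
        lookup ((f ^ʷ v) (st x)) (l ↑ˡ k)    ≡⟨ lookup-take ((f ^ʷ v) (st x)) l ⟨
        lookup (take n ((f ^ʷ v) (st x))) l  ≡⟨ cong (λ u → lookup u l) (fin x) ⟩
        lookup (h x) l                       ∎
    ; lookup-notUpdated = keep
    }
    where open ≡-Reasoning
  -- With the word exhausted, every original coordinate is in `S`, so its size `n ≥ K` would have
  -- been `K`.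
  cut-from [] S st _ ∣S∣≤K ∉v ∈v fin keep | no ∣S∣≢K =
    contradiction (ℕ.≤-antisym ∣S∣≤K (begin
      K           ≤⟨ K≤n ⟩
      n           ≡⟨ Subset.∣⊤∣≡n n ⟨
      ∣ ⊤ {n} ∣ ≤⟨ Subset.p⊆q⇒∣p∣≤∣q∣ {p = ⊤} (λ {l} _ → full l) ⟩
      ∣ S ∣       ∎)) ∣S∣≢K
    where
    open ℕ.≤-Reasoning
    full : ∀ l → l ∈ S
    full l with l Subset.∈? S
    ... | yes l∈S = l∈S
    ... | no  l∉S with () ← ∈v l l∉S
  cut-from (j ∷ v) S st (j≢ ∷ v-uniq) ∣S∣≤K ∉v ∈v fin keep | no ∣S∣≢K
    with splitAt n j | Fin.join-splitAt n k j
  ... | inj₁ i | refl = cut-from v (S ∪ ⁅ i ⁆) (λ x → (f ⟪ i ↑ˡ k ⟫) (st x)) v-uniq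
    -- The size grows by at most one per letter, so it cannot jump over `K`.
    (ℕ.≤-trans (∣p∪⁅x⁆∣≤1+∣p∣ S i) (ℕ.≤∧≢⇒< ∣S∣≤K ∣S∣≢K))
    ∉v′
    (λ l l∉S∪i → VecAny.tail (λ eq → ≢i l∉S∪i (Fin.↑ˡ-injective k l i eq)) (∈v l (∉S l∉S∪i)))
    fin
    (λ x l l∉S∪i → trans
      (Vec.lookup∘update′ (λ eq → ≢i l∉S∪i (Fin.↑ˡ-injective k l i eq)) (st x) _)
      (keep x l (∉S l∉S∪i)))
    where
    ≢i : ∀ {l} → l ∉ S ∪ ⁅ i ⁆ → l ≢ i
    ≢i l∉S∪i refl = l∉S∪i (Subset.x∈p∪q⁺ (inj₂ (Subset.x∈⁅x⁆ i)))
    ∉S : ∀ {l} → l ∉ S ∪ ⁅ i ⁆ → l ∉ S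
    ∉S l∉S∪i l∈S = l∉S∪i (Subset.x∈p∪q⁺ (inj₁ l∈S))
    ∉v′ : ∀ l → l ∈ S ∪ ⁅ i ⁆ → l ↑ˡ k ∉ᵛ v
    ∉v′ l l∈S∪i l∈v with Subset.x∈p∪q⁻ S ⁅ i ⁆ l∈S∪i
    ... | inj₁ l∈S = ∉v l l∈S (VecAny.there l∈v)
    -- The letter just read does not recur, since the word has no repetitions.
    ... | inj₂ l∈i with refl ← Subset.x∈⁅y⁆⇒x≡y i l∈i = VecAll.lookup j≢ l∈v refl
  ... | inj₂ i | refl = cut-from v S (λ x → (f ⟪ n ↑ʳ i ⟫) (st x)) v-uniq ∣S∣≤K
    (λ l l∈S → ∉v l l∈S ∘ VecAny.there)
    (λ l l∉S → VecAny.tail ↑ˡ≢↑ʳ (∈v l l∉S))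
    fin
    (λ x l l∉S → trans (Vec.lookup∘update′ ↑ˡ≢↑ʳ (st x) _) (keep x l l∉S))
    where
    ↑ˡ≢↑ʳ : ∀ {l} → l ↑ˡ k ≢ n ↑ʳ i
    ↑ˡ≢↑ʳ {l} eq with () ← trans (sym (Fin.splitAt-↑ˡ n l k)) (trans (cong (splitAt n) eq) (Fin.splitAt-↑ʳ n k i))

  cut : (w : Π (n ℕ.+ k)) → Sequentializes k f w h → Fin q → Cut h K k
  cut (w , w-inj , w-sur) seq o = cut-from w ⊥ (_++ replicate k o)
    (subst Unique (Vec.tabulate∘lookup w) (Unique.tabulate⁺ w-inj))
    (subst (ℕ._≤ K) (sym (Subset.∣⊥∣≡0 n)) ℕ.z≤n)
    (λ l l∈⊥ → contradiction l∈⊥ Subset.∉⊥)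
    (λ l _ → let i , eq = w-sur (l ↑ˡ k) in subst (_∈ᵛ w) (eq refl) (Vec.∈-lookup i w))
    (λ x → trans (seq (x ++ replicate k o)) (cong h (lookup-ext λ l →
      trans (lookup-take (x ++ replicate k o) l) (Vec.lookup-++ˡ x (replicate k o) l))))
    (λ x l _ → Vec.lookup-++ˡ x (replicate k o) l)

cut-separates : ∀ {n q K k m} {h : F n q} (c : Cut h K k) {x : Fin m → State n q} →
  Confusable (Cut.updated c) h x → m ℕ.≤ q ℕ.^ k
cut-separates {n} {q} {k = k} {m} {h} c {x} conf = Fin.injective⇒≤ {f = encV ∘ drop n ∘ current ∘ x} inj
  where
  open Cut c
  open Confusable conf
  open ≡-Reasoning

  same-original : ∀ i j l → lookup (current (x i)) (l ↑ˡ k) ≡ lookup (current (x j)) (l ↑ˡ k)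
  same-original i j l with l Subset.∈? updated
  ... | yes l∈S = trans (lookup-updated (x i) l l∈S)
                    (trans (agree-inside i j l l∈S) (sym (lookup-updated (x j) l l∈S)))
  ... | no  l∉S = trans (lookup-notUpdated (x i) l l∉S)
                    (trans (agree-outside i j l l∉S) (sym (lookup-notUpdated (x j) l l∉S)))

  inj : Injective _≡_ _≡_ (encV ∘ drop n ∘ current ∘ x)
  inj {i} {j} eq = distinct (begin
    h (x i)                 ≡⟨ finish-current (x i) ⟨
    finish (current (x i))  ≡⟨ cong finish same ⟩
    finish (current (x j))  ≡⟨ finish-current (x j) ⟩
    h (x j)                 ∎)
    where
    same : current (x i) ≡ current (x j)
    same = begin
      current (x i)
        ≡⟨ Vec.take++drop≡id n _ ⟨
      take n (current (x i)) ++ drop n (current (x i))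
        ≡⟨ cong₂ _++_
             (lookup-ext λ l → trans (lookup-take (current (x i)) l)
               (trans (same-original i j l) (sym (lookup-take (current (x j)) l))))
             (trans (sym (decV-encV (drop n (current (x i)))))
               (trans (cong decV eq) (decV-encV (drop n (current (x j)))))) ⟩
      take n (current (x j)) ++ drop n (current (x j))
        ≡⟨ Vec.take++drop≡id n _ ⟩
      current (x j) ∎

2K≤n⇒K≤κᵐⁱⁿ-max : ∀ {q n} K → 4 ℕ.≤ q → 2 ℕ.* K ℕ.≤ n → K ℕ.≤ κᵐⁱⁿ-max n q
2K≤n⇒K≤κᵐⁱⁿ-max ℕ.zero    4≤q 2K≤n = ℕ.z≤n
2K≤n⇒K≤κᵐⁱⁿ-max {q} {n} (ℕ.suc k) 4≤q 2K≤n
  with h , confused ← confusing-map {n} {q} k 4≤q 2K≤n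
  with f , w , seq ← proj₁ (κᵐⁱⁿ-isLeast h)
  = ℕ.≤-trans (ℕ.≮⇒≥ κ≮K) (proj₂ (κᵐⁱⁿ-max-isGreatest n q) (κᵐⁱⁿ h) (h , refl))
  where
  0<q : 0 ℕ.< q
  0<q = ℕ.<-≤-trans (ℕ.s≤s ℕ.z≤n) 4≤q

  c : Cut h (ℕ.suc k) (κᵐⁱⁿ h)
  c = cut f h (ℕ.≤-trans (ℕ.m≤m+n _ _) 2K≤n) w seq (fromℕ< 0<q)

  κ≮K : ¬ κᵐⁱⁿ h ℕ.< ℕ.suc k
  κ≮K (ℕ.s≤s κ≤k) = ℕ.<-irrefl refl (begin-strict
    q ℕ.^ k            <⟨ cut-separates c (proj₂ (confused (Cut.updated c) (Cut.∣updated∣ c))) ⟩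
    q ℕ.^ κᵐⁱⁿ h       ≤⟨ ℕ.^-monoʳ-≤ q ⦃ ℕ.>-nonZero 0<q ⦄ κ≤k ⟩
    q ℕ.^ k            ∎)
    where open ℕ.≤-Reasoning

k≤n/2−log⇒2k≤n : ∀ {q n} k → 1 ℕ.< q → 1 ℕ.≤ n → (+ k) ≤n/2−log[ q ] n → 2 ℕ.* k ℕ.≤ n
k≤n/2−log⇒2k≤n {q} {n} k 1<q 1≤n = go (+ n ℤ.* + 1 ℤ.+ (ℤ.- + k) ℤ.* + 2) refl
  where
  go : ∀ z → + n ℤ.* + 1 ℤ.+ (ℤ.- + k) ℤ.* + 2 ≡ z → log[ q ] n ≤ mkℚᵘ z 1 → 2 ℕ.* k ℕ.≤ n
  go (+ a) eq _ = subst₂ ℕ._≤_ (ℕ.*-comm k 2) (ℕ.*-identityʳ n)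
    (ℤ.drop‿+≤+ (subst₂ _≤_ (sym (ℤ.pos-* k 2)) (sym (ℤ.pos-* n 1))
      (ℤ.0≤i-j⇒j≤i (subst (+ 0 ≤_)
        (sym (trans (cong (λ z → + n ℤ.* + 1 ℤ.+ z) (ℤ.neg-distribˡ-* (+ k) (+ 2))) eq))
        (+≤+ ℕ.z≤n)))))
  go -[1+ a ] _ n²q^a≤1 = contradiction n²q^a≤1 (ℕ.<⇒≱ (begin-strict
    1                            <⟨ 1<q ⟩
    q                            ≡⟨ ℕ.*-identityʳ q ⟨
    q ℕ.^ 1                      ≤⟨ ℕ.^-monoʳ-≤ q ⦃ ℕ.>-nonZero (ℕ.<⇒≤ 1<q) ⦄ {1} {ℕ.suc a} (ℕ.s≤s ℕ.z≤n) ⟩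
    q ℕ.^ ℕ.suc a                ≡⟨ ℕ.*-identityˡ _ ⟨
    1 ℕ.* q ℕ.^ ℕ.suc a          ≤⟨ ℕ.*-monoˡ-≤ (q ℕ.^ ℕ.suc a) (ℕ.^-monoˡ-≤ 2 1≤n) ⟩
    n ℕ.^ 2 ℕ.* q ℕ.^ ℕ.suc a    ∎))
    where open ℕ.≤-Reasoning

mainTheorem6 : (q n : ℕ) → q ℕ.≥ 4 → n ℕ.≥ 1 →
    (k : ℤ) → k Is⌊n/2−log[ q ] n ⌋ → k ≤ + κᵐⁱⁿ-max n q
mainTheorem6 q n 4≤q 1≤n -[1+ k ] _           = -≤+
mainTheorem6 q n 4≤q 1≤n (+ k)    (k≤ , _) = +≤+ (2K≤n⇒K≤κᵐⁱⁿ-max k 4≤q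
  (k≤n/2−log⇒2k≤n k (ℕ.≤-trans (ℕ.s≤s (ℕ.s≤s ℕ.z≤n)) 4≤q) 1≤n k≤))
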